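{- Let $d\geq 1$ be an integer and $0<\epsilon\leq 1$. There is an adaptive randomized algorithm which, given $d$, $\epsilon$ and query access to a $0,1$ matrix $M$ of size $n\times m$ with $\operatorname{rank}_{\mathrm{bin}}(M)\leq d$, outputs with probability at least $5/6$ two $0,1$ matrices $A'$ and $B'$ of size $n\times d$ and $d\times m$, respectively, such that $M'=A'\cdot B'$ is a $0,1$ matrix with $\operatorname{dist}(M,M')\leq O(\epsilon)$. The query complexity of the algorithm is $O\left(d(n+m)+\frac{d^3\log(d+1)}{\epsilon^2}\right)$. (The implied constants are absolute.)
   Context: The binary rank $\operatorname{rank}_{\mathrm{bin}}(M)$ of a $0,1$ matrix $M$ of size $n\times m$ is the minimal $d$ for which there exist $0,1$ matrices $A$ and $B$ of sizes $n\times d$ and $d\times m$, respectively, such that $M=A\cdot B$, where the operations are over the integers. The product $A'\cdot B'$ is also computed over the integers. The distance between two $0,1$ matrices $M,M'$ of size $n\times m$ is $\operatorname{dist}(M,M')=\frac{|\{(i,j) : M_{i,j}\neq M'_{i,j}\}|}{n\cdot m}$. The query complexity of an algorithm is the number of entries of $M$ which it queries. An algorithm is adaptive if its queries may depend on the answers to previous queries (as well as on the input parameters and its random coin tosses). -}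

module Defs where

open import Data.Bool using (Bool; if_then_else_)
open import Data.Fin using (Fin)
open import Data.Fin.Properties using (all?)
open import Data.Integer using (+_)
open import Data.Nat as ℕ using (ℕ; suc; NonZero)
import Data.Nat.Properties as ℕ
open import Data.Nat.Logarithm using (⌈log₂_⌉)
open import Data.Product using (Σ-syntax; _×_; _,_)
open import Data.Rational using (ℚ; 0ℚ; 1ℚ; _+_; _*_; _÷_; _/_; _≤_; Positive)
open import Data.Rational.Properties using (_≤?_; pos⇒nonZero; pos*pos⇒pos; +-0-commutativeMonoid)
open import Data.Sum using (_⊎_)
open import Data.Vec.Functional using (Vector; foldr)
open import Relation.Binary.PropositionalEquality using (_≡_)
open import Relation.Nullary using (does)
open import Relation.Nullary.Decidable using (_×-dec_; _⊎-dec_)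
open import Relation.Unary using (Pred; Decidable)
open import Level using (0ℓ)

import Algebra.Properties.CommutativeMonoid.Sum as Sum

open Sum ℕ.+-0-commutativeMonoid public using () renaming (sum to sumℕ)
open Sum +-0-commutativeMonoid public using () renaming (sum to sumℚ)

fromℕ : ℕ → ℚ
fromℕ k = + k / 1

Matrix : Set → ℕ → ℕ → Set
Matrix X n m = Vector (Vector X m) n

BinMatrix : ℕ → ℕ → Set
BinMatrix = Matrix Bool

bit : Bool → ℕ
bit b = if b then 1 else 0

⟦_⟧ : ∀ {n m} → BinMatrix n m → Matrix ℕ n m
⟦ M ⟧ i j = bit (M i j)

infixl 7 _·_

-- The integer product; its entries are nonnegative, so they are taken in ℕ.
_·_ : ∀ {n d m} → BinMatrix n d → BinMatrix d m → Matrix ℕ n m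
(A · B) i j = sumℕ (λ k → bit (A i k) ℕ.* bit (B k j))

Factors : ∀ {n m} → BinMatrix n m → ℕ → Set
Factors {n} {m} M d =
  Σ[ A ∈ BinMatrix n d ] Σ[ B ∈ BinMatrix d m ] (∀ i j → ⟦ M ⟧ i j ≡ (A · B) i j)

-- IsBinaryRank M r says that rank_bin(M) = r.
IsBinaryRank : ∀ {n m} → BinMatrix n m → ℕ → Set
IsBinaryRank M r = Factors M r × (∀ d → Factors M d → r ℕ.≤ d)

Is01 : ∀ {n m} → Matrix ℕ n m → Set
Is01 N = ∀ i j → N i j ≡ 0 ⊎ N i j ≡ 1

mismatches : ∀ {n m} → Matrix ℕ n m → Matrix ℕ n m → ℕ
mismatches N N′ = sumℕ (λ i → sumℕ (λ j → if does (N i j ℕ.≟ N′ i j) then 0 else 1))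

dist : ∀ {n m} .{{_ : NonZero n}} .{{_ : NonZero m}} →
       Matrix ℕ n m → Matrix ℕ n m → ℚ
dist {n} {m} N N′ = (+ mismatches N N′ / (n ℕ.* m)) {{ℕ.m*n≢0 n m}}

-- Adaptive randomized algorithms with query access to an n × m binary matrix:
-- each step may depend on all earlier answers and coin tosses.
-- `toss k` draws a uniform element of Fin (suc k), independently of the past.
data Algorithm (n m : ℕ) (O : Set) : Set where
  output : O → Algorithm n m O
  query  : Fin n → Fin m → (Bool → Algorithm n m O) → Algorithm n m O
  toss   : (k : ℕ) → (Fin (suc k) → Algorithm n m O) → Algorithm n m O

-- The probability, over the coin tosses, that the output on input M satisfies P.
Pr : ∀ {n m O} {P : Pred O 0ℓ} → Decidable P → Algorithm n m O → BinMatrix n m → ℚ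
Pr P? (output o)    M = if does (P? o) then 1ℚ else 0ℚ
Pr P? (query i j f) M = Pr P? (f (M i j)) M
Pr P? (toss k f)    M = (+ 1 / suc k) * sumℚ (λ x → Pr P? (f x) M)

-- The number of queries made on input M, maximised over the coin tosses.
queries : ∀ {n m O} → Algorithm n m O → BinMatrix n m → ℕ
queries (output o)    M = 0
queries (query i j f) M = suc (queries (f (M i j)) M)
queries (toss k f)    M = foldr ℕ._⊔_ 0 (λ x → queries (f x) M)

Approximates : ∀ {n m d} .{{_ : NonZero n}} .{{_ : NonZero m}} →
               BinMatrix n m → ℚ → Pred (BinMatrix n d × BinMatrix d m) 0ℓ
Approximates M δ (A , B) = Is01 (A · B) × dist ⟦ M ⟧ (A · B) ≤ δ

approximates? : ∀ {n m d} .{{_ : NonZero n}} .{{_ : NonZero m}} →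
                (M : BinMatrix n m) (δ : ℚ) → Decidable (Approximates {d = d} M δ)
approximates? M δ (A , B) =
  all? (λ i → all? (λ j → ((A · B) i j ℕ.≟ 0) ⊎-dec ((A · B) i j ℕ.≟ 1)))
  ×-dec (dist ⟦ M ⟧ (A · B) ≤? δ)

-- d(n+m) + d³ log(d+1) / ε².  For d ≥ 1, rounding the logarithm up changes it by
-- at most a factor of 2.
complexity : (d : ℕ) (ε : ℚ) .{{_ : Positive ε}} (n m : ℕ) → ℚ
complexity d ε n m =
  fromℕ (d ℕ.* (n ℕ.+ m)) +
  (fromℕ (d ℕ.^ 3 ℕ.* ⌈log₂ suc d ⌉) ÷ (ε * ε)) {{pos⇒nonZero (ε * ε) {{pos*pos⇒pos ε ε}}}}

{-# OPTIONS --safe #-}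

-- Cross approximation over the field with two elements.  A factorization of M over ℤ is
-- one over 𝔽₂, so M has 𝔽₂-rank at most d.  Keep an approximation N, initially 0, and
-- sample uniform positions.  Whenever the residual M + N is 1 at a sampled (i , j), query
-- row i and column j of M and add to N the product of column j and row i of the residual;
-- this lowers the 𝔽₂-rank of the residual by one.  Hence at most d samples can hit an
-- error, and after t samples, with t uniform in {0,…,6dK} for K = 1 + ⌊1/ε⌋, the density
-- of the residual exceeds ε with probability at most 1/6.  Finally output, without further
-- queries, any binary factorization ε-close to N; if M is ε-close to N, then one exists and
-- it is 2ε-close to M.
module Submission where

open import Defs

open import Algebra.Bundles using (CommutativeRing)
import Algebra.Properties.Semiring.Sum as SemiringSum
open import Data.Bool using (Bool; true; false; _∧_; _xor_; not; if_then_else_)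
open import Data.Bool.Properties
  using (xor-∧-commutativeRing; xor-assoc; xor-comm; xor-same; xor-identityʳ;
         not-distribˡ-xor; ∧-assoc; ∧-identityʳ)
open import Data.Fin using (Fin; zero; suc; punchIn; toℕ; combine; remQuot)
open import Data.Fin.Properties using (toℕ≤pred[n]; remQuot-combine)
open import Data.Fin.Subset using (Subset)
open import Data.Fin.Subset.Properties using (anySubset?)
open import Data.Integer as ℤ using (+_)
import Data.Integer.Properties as ℤ
open import Data.Nat as ℕ using (ℕ; zero; suc; NonZero) renaming (_≤_ to _≤ℕ_)
import Data.Nat.DivMod as ℕ
open import Data.Nat.Logarithm using (⌈log₂_⌉; ⌈log₂⌉-mono-≤)
import Data.Nat.Properties as ℕ
open import Data.Nat.Solver renaming (module +-*-Solver to ℕSolver)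
open import Data.Product using (Σ-syntax; ∃-syntax; _×_; _,_; proj₁; proj₂; uncurry)
open import Data.Rational
  using (ℚ; mkℚ; 0ℚ; 1ℚ; _+_; _-_; -_; _*_; _/_; 1/_; _≤_; *≤*;
         Positive; NonNegative; nonNegative; ↥_; ↧ₙ_; toℚᵘ)
open import Data.Rational.Properties as ℚ using (+-*-commutativeRing)
open import Data.Rational.Solver using (module +-*-Solver)
open import Data.Rational.Unnormalised as ℚᵘ using (mkℚᵘ)
import Data.Rational.Unnormalised.Properties as ℚᵘ
open import Data.Sum using (_⊎_; inj₁; inj₂; [_,_]′)
import Data.Vec as Vec
import Data.Vec.Properties as Vec
open import Data.Vec.Functional using (Vector; removeAt; foldr; _∷_)
open import Function using (_∘_)
open import Level using (0ℓ)
open import Relation.Binary.PropositionalEquality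
open import Relation.Nullary using (Dec; does; yes; no; contradiction)
open import Relation.Nullary.Decidable using (dec-true)
open import Relation.Unary using (Pred; Decidable)

open CommutativeRing xor-∧-commutativeRing using ()
  renaming (distribˡ to ∧-distribˡ-xor; distribʳ to ∧-distribʳ-xor; zeroʳ to ∧-zeroʳ)
open SemiringSum (CommutativeRing.semiring xor-∧-commutativeRing) using ()
  renaming (sum to ⨁; sum-cong-≗ to ⨁-cong; sum-remove to ⨁-remove;
            ∑-distrib-+ to ⨁-distrib-xor; *-distribˡ-sum to ∧-distribˡ-⨁; *-distribʳ-sum to ∧-distribʳ-⨁)
open SemiringSum ℕ.+-*-semiring using () renaming (sum-cong-≗ to sumℕ-cong)
private module ∑ℚ = SemiringSum (CommutativeRing.semiring +-*-commutativeRing)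

private variable
  n m r d k : ℕ
  O : Set

-- Rank over the field with two elements

RankAtMost : ℕ → BinMatrix n m → Set
RankAtMost {n} {m} r E =
  Σ[ A ∈ BinMatrix n r ] Σ[ B ∈ BinMatrix r m ] (∀ i j → E i j ≡ ⨁ (λ k → A i k ∧ B k j))

⨁-witness : (f : Vector Bool k) → ⨁ f ≡ true → ∃[ p ] f p ≡ true
⨁-witness {suc k} f eq with f zero in f₀
... | true  = zero , f₀
... | false = let p , fp = ⨁-witness (f ∘ suc) eq in suc p , fp

∧-trueʳ : ∀ x {y} → x ∧ y ≡ true → y ≡ true
∧-trueʳ true eq = eq

deflate : Fin n → Fin m → BinMatrix n m → BinMatrix n m
deflate i j E r c = E r c xor (E r j ∧ E i c)

-- With x the j-th column of B and y the i-th row of A, deflation replaces A by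
-- A (I + x yᵀ), which kills x because yᵀ x = E i j = 1.  Hence multiples of row p
-- may be added to the rows of B according to x; where x p = 1 this clears row p.
deflate-rank : ∀ {i j} (E : BinMatrix n m) → E i j ≡ true →
               RankAtMost (suc r) E → RankAtMost r (deflate i j E)
deflate-rank {n} {m} {r} {i} {j} E Eij (A , B , E≗AB) =
  (λ s → removeAt (A′ s) p) , (λ k → B′ (punchIn p k)) , deflated
  where
  A′ : BinMatrix n (suc r)
  A′ s k = A s k xor (E s j ∧ A i k)

  -- A sum over 𝔽₂ that equals 1 has a term equal to 1; here the sum is the factored form of
  -- `E i j`.
  pivot : ∃[ p ] A i p ∧ B p j ≡ true
  pivot = ⨁-witness (λ k → A i k ∧ B k j) (trans (sym (E≗AB i j)) Eij)

  p = proj₁ pivot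
  Bpj : B p j ≡ true
  Bpj = ∧-trueʳ (A i p) (proj₂ pivot)

  B′ : BinMatrix (suc r) m
  B′ k c = B k c xor (B k j ∧ B p c)

  A′B : ∀ s c → ⨁ (λ k → A′ s k ∧ B k c) ≡ deflate i j E s c
  A′B s c = begin
    ⨁ (λ k → A′ s k ∧ B k c)
      ≡⟨ ⨁-cong (λ k → trans (∧-distribʳ-xor (B k c) (A s k) _)
                             (cong ((A s k ∧ B k c) xor_) (∧-assoc (E s j) (A i k) (B k c)))) ⟩
    ⨁ (λ k → (A s k ∧ B k c) xor (E s j ∧ (A i k ∧ B k c)))
      ≡⟨ ⨁-distrib-xor (λ k → A s k ∧ B k c) (λ k → E s j ∧ (A i k ∧ B k c)) ⟩
    ⨁ (λ k → A s k ∧ B k c) xor ⨁ (λ k → E s j ∧ (A i k ∧ B k c))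
      ≡⟨ cong₂ _xor_ (E≗AB s c) (∧-distribˡ-⨁ (E s j) (λ k → A i k ∧ B k c)) ⟨
    E s c xor (E s j ∧ ⨁ (λ k → A i k ∧ B k c))
      ≡⟨ cong (λ e → E s c xor (E s j ∧ e)) (E≗AB i c) ⟨
    deflate i j E s c ∎
    where open ≡-Reasoning

  A′x : ∀ s → ⨁ (λ k → A′ s k ∧ B k j) ≡ false
  A′x s = begin
    ⨁ (λ k → A′ s k ∧ B k j)    ≡⟨ A′B s j ⟩
    E s j xor (E s j ∧ E i j)   ≡⟨ cong (λ e → E s j xor (E s j ∧ e)) Eij ⟩
    E s j xor (E s j ∧ true)    ≡⟨ cong (E s j xor_) (∧-identityʳ (E s j)) ⟩
    E s j xor E s j             ≡⟨ xor-same (E s j) ⟩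
    false                       ∎
    where open ≡-Reasoning

  A′B′ : ∀ s c → ⨁ (λ k → A′ s k ∧ B′ k c) ≡ deflate i j E s c
  A′B′ s c = begin
    ⨁ (λ k → A′ s k ∧ B′ k c)
      ≡⟨ ⨁-cong (λ k → trans (∧-distribˡ-xor (A′ s k) (B k c) _)
                             (cong ((A′ s k ∧ B k c) xor_) (sym (∧-assoc (A′ s k) (B k j) (B p c))))) ⟩
    ⨁ (λ k → (A′ s k ∧ B k c) xor ((A′ s k ∧ B k j) ∧ B p c))
      ≡⟨ ⨁-distrib-xor (λ k → A′ s k ∧ B k c) (λ k → (A′ s k ∧ B k j) ∧ B p c) ⟩
    ⨁ (λ k → A′ s k ∧ B k c) xor ⨁ (λ k → (A′ s k ∧ B k j) ∧ B p c)
      ≡⟨ cong₂ _xor_ (A′B s c) (sym (∧-distribʳ-⨁ (B p c) (λ k → A′ s k ∧ B k j))) ⟩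
    deflate i j E s c xor (⨁ (λ k → A′ s k ∧ B k j) ∧ B p c)
      ≡⟨ cong (λ e → deflate i j E s c xor (e ∧ B p c)) (A′x s) ⟩
    deflate i j E s c xor false
      ≡⟨ xor-comm _ false ⟩
    deflate i j E s c ∎
    where open ≡-Reasoning

  cleared : ∀ s c → A′ s p ∧ B′ p c ≡ false
  cleared s c = begin
    A′ s p ∧ (B p c xor (B p j ∧ B p c))  ≡⟨ cong (λ e → A′ s p ∧ (B p c xor (e ∧ B p c))) Bpj ⟩
    A′ s p ∧ (B p c xor B p c)            ≡⟨ cong (A′ s p ∧_) (xor-same (B p c)) ⟩
    A′ s p ∧ false                        ≡⟨ ∧-zeroʳ (A′ s p) ⟩
    false                                 ∎
    where open ≡-Reasoning

  deflated : ∀ s c → deflate i j E s c ≡ ⨁ (removeAt (λ k → A′ s k ∧ B′ k c) p)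
  deflated s c = begin
    deflate i j E s c
      ≡⟨ A′B′ s c ⟨
    ⨁ (λ k → A′ s k ∧ B′ k c)
      ≡⟨ ⨁-remove {i = p} (λ k → A′ s k ∧ B′ k c) ⟩
    (A′ s p ∧ B′ p c) xor ⨁ (removeAt (λ k → A′ s k ∧ B′ k c) p)
      ≡⟨ cong (_xor ⨁ (removeAt (λ k → A′ s k ∧ B′ k c) p)) (cleared s c) ⟩
    ⨁ (removeAt (λ k → A′ s k ∧ B′ k c) p) ∎
    where open ≡-Reasoning

-- Reduction of integer factorizations modulo 2

parity : ℕ → Bool
parity zero    = false
parity (suc k) = not (parity k)

parity-+ : ∀ a b → parity (a ℕ.+ b) ≡ parity a xor parity b
parity-+ zero    b = refl
parity-+ (suc a) b = trans (cong not (parity-+ a b)) (not-distribˡ-xor (parity a) (parity b))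

parity-bit : ∀ b → parity (bit b) ≡ b
parity-bit true  = refl
parity-bit false = refl

parity-bit* : ∀ a b → parity (bit a ℕ.* bit b) ≡ a ∧ b
parity-bit* true  true  = refl
parity-bit* true  false = refl
parity-bit* false b     = refl

parity-sum : (f : Vector ℕ k) → parity (sumℕ f) ≡ ⨁ (parity ∘ f)
parity-sum {zero}  f = refl
parity-sum {suc k} f =
  trans (parity-+ (f zero) _) (cong (parity (f zero) xor_) (parity-sum (f ∘ suc)))

-- Reduce the integer identity modulo 2: `parity` turns sums into `xor` and products of bits into
-- `∧`.
factors⇒rank : (M : BinMatrix n m) → Factors M r → RankAtMost r M
factors⇒rank M (A , B , M≗AB) = A , B , λ i j → begin
  M i j                                            ≡⟨ parity-bit (M i j) ⟨
  parity (bit (M i j))                             ≡⟨ cong parity (M≗AB i j) ⟩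
  parity ((A · B) i j)                             ≡⟨ parity-sum (λ k → bit (A i k) ℕ.* bit (B k j)) ⟩
  ⨁ (λ k → parity (bit (A i k) ℕ.* bit (B k j)))   ≡⟨ ⨁-cong (λ k → parity-bit* (A i k) (B k j)) ⟩
  ⨁ (λ k → A i k ∧ B k j)                          ∎
  where open ≡-Reasoning

-- Pad A with a zero column and B with a zero row. The extra term of each entry computes to 0, so
-- the old equations still apply.
factors-mono : (M : BinMatrix n m) → r ℕ.≤′ d → Factors M r → Factors M d
factors-mono M ℕ.≤′-refl       F = F
factors-mono M (ℕ.≤′-step r≤d) F with factors-mono M r≤d F
... | A , B , M≗AB = (λ i → false ∷ A i) , ((λ j → false) ∷ B) , M≗AB

-- Averages and distances

-- Fractions in ℚ are kept in lowest terms, so the identities below are checked on unnormalised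
-- fractions, where equality is cross multiplication.
toℚᵘ-/ : ∀ a k → toℚᵘ (+ a / suc k) ℚᵘ.≃ mkℚᵘ (+ a) k
toℚᵘ-/ a k = ℚ.toℚᵘ-fromℚᵘ (mkℚᵘ (+ a) k)

/-*-/ : ∀ a b c d → (+ a / suc b) * (+ c / suc d) ≡ + (a ℕ.* c) / (suc b ℕ.* suc d)
/-*-/ a b c d = ℚ.toℚᵘ-injective (begin
  toℚᵘ ((+ a / suc b) * (+ c / suc d))           ≈⟨ ℚ.toℚᵘ-homo-* (+ a / suc b) (+ c / suc d) ⟩
  toℚᵘ (+ a / suc b) ℚᵘ.* toℚᵘ (+ c / suc d)     ≈⟨ ℚᵘ.*-cong (toℚᵘ-/ a b) (toℚᵘ-/ c d) ⟩
  mkℚᵘ (+ a) b ℚᵘ.* mkℚᵘ (+ c) d                 ≡⟨ cong (λ z → mkℚᵘ z (d ℕ.+ b ℕ.* suc d)) (sym (ℤ.pos-* a c)) ⟩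
  mkℚᵘ (+ (a ℕ.* c)) (d ℕ.+ b ℕ.* suc d)         ≈⟨ toℚᵘ-/ (a ℕ.* c) (d ℕ.+ b ℕ.* suc d) ⟨
  toℚᵘ (+ (a ℕ.* c) / (suc b ℕ.* suc d))         ∎)
  where open ℚᵘ.≃-Reasoning

fromℕ-* : ∀ a b → fromℕ (a ℕ.* b) ≡ fromℕ a * fromℕ b
fromℕ-* a b = sym (/-*-/ a 0 b 0)

fromℕ-+ : ∀ a b → fromℕ (a ℕ.+ b) ≡ fromℕ a + fromℕ b
fromℕ-+ a b = ℚ.toℚᵘ-injective (begin
  toℚᵘ (fromℕ (a ℕ.+ b))              ≈⟨ toℚᵘ-/ (a ℕ.+ b) 0 ⟩
  mkℚᵘ (+ (a ℕ.+ b)) 0                ≡⟨ cong (λ z → mkℚᵘ z 0) (trans (ℤ.pos-+ a b)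
                                          (cong₂ ℤ._+_ (sym (ℤ.*-identityʳ (+ a))) (sym (ℤ.*-identityʳ (+ b))))) ⟩
  mkℚᵘ (+ a) 0 ℚᵘ.+ mkℚᵘ (+ b) 0      ≈⟨ ℚᵘ.+-cong (toℚᵘ-/ a 0) (toℚᵘ-/ b 0) ⟨
  toℚᵘ (fromℕ a) ℚᵘ.+ toℚᵘ (fromℕ b)  ≈⟨ ℚ.toℚᵘ-homo-+ (fromℕ a) (fromℕ b) ⟨
  toℚᵘ (fromℕ a + fromℕ b)            ∎)
  where open ℚᵘ.≃-Reasoning

fromℕ-mono : ∀ {a b} → a ℕ.≤ b → fromℕ a ≤ fromℕ b
fromℕ-mono {a} {b} a≤b = ℚ.toℚᵘ-cancel-≤ (begin
  toℚᵘ (fromℕ a)  ≃⟨ toℚᵘ-/ a 0 ⟩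
  mkℚᵘ (+ a) 0    ≤⟨ ℚᵘ.*≤* (ℤ.*-monoʳ-≤-nonNeg (+ 1) (ℤ.+≤+ a≤b)) ⟩
  mkℚᵘ (+ b) 0    ≃⟨ toℚᵘ-/ b 0 ⟨
  toℚᵘ (fromℕ b)  ∎)
  where open ℚᵘ.≤-Reasoning

fromℕ-sum : (f : Vector ℕ k) → fromℕ (sumℕ f) ≡ sumℚ (fromℕ ∘ f)
fromℕ-sum {zero}  f = refl
fromℕ-sum {suc k} f =
  trans (fromℕ-+ (f zero) (sumℕ (f ∘ suc))) (cong (_+_ (fromℕ (f zero))) (fromℕ-sum (f ∘ suc)))

-- The same expression as in `Pr` at a `toss`, so the probability after a toss is by definition an
-- average over its outcomes.
avg : (k : ℕ) → Vector ℚ (suc k) → ℚ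
avg k f = (+ 1 / suc k) * sumℚ f

avg-cong : {f g : Vector ℚ (suc k)} → f ≗ g → avg k f ≡ avg k g
avg-cong {k} f≗g = cong (_*_ (+ 1 / suc k)) (∑ℚ.sum-cong-≗ f≗g)

sumℚ-mono : {f g : Vector ℚ k} → (∀ x → f x ≤ g x) → sumℚ f ≤ sumℚ g
sumℚ-mono {zero}  f≤g = ℚ.≤-refl
sumℚ-mono {suc k} f≤g = ℚ.+-mono-≤ (f≤g zero) (sumℚ-mono (f≤g ∘ suc))

avg-mono : {f g : Vector ℚ (suc k)} → (∀ x → f x ≤ g x) → avg k f ≤ avg k g
avg-mono {k} f≤g =
  ℚ.*-monoˡ-≤-nonNeg (+ 1 / suc k) {{ℚ.normalize-nonNeg 1 (suc k)}} (sumℚ-mono f≤g)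

avg-+ : (f g : Vector ℚ (suc k)) → avg k (λ x → f x + g x) ≡ avg k f + avg k g
avg-+ {k} f g =
  trans (cong (_*_ (+ 1 / suc k)) (∑ℚ.∑-distrib-+ f g)) (ℚ.*-distribˡ-+ (+ 1 / suc k) (sumℚ f) (sumℚ g))

*-avg : (c : ℚ) (f : Vector ℚ (suc k)) → c * avg k f ≡ avg k (λ x → c * f x)
*-avg {k} c f = begin
  c * (u * sumℚ f)       ≡⟨ ℚ.*-assoc c u (sumℚ f) ⟨
  (c * u) * sumℚ f       ≡⟨ cong (λ z → z * sumℚ f) (ℚ.*-comm c u) ⟩
  (u * c) * sumℚ f       ≡⟨ ℚ.*-assoc u c (sumℚ f) ⟩
  u * (c * sumℚ f)       ≡⟨ cong (_*_ u) (∑ℚ.*-distribˡ-sum c f) ⟩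
  avg k (λ x → c * f x)  ∎
  where open ≡-Reasoning
        u = + 1 / suc k

sumℚ-const : ∀ k c → sumℚ {k} (λ _ → c) ≡ fromℕ k * c
sumℚ-const zero    c = sym (ℚ.*-zeroˡ c)
sumℚ-const (suc k) c = begin
  c + sumℚ {k} (λ _ → c)   ≡⟨ cong₂ _+_ (sym (ℚ.*-identityˡ c)) (sumℚ-const k c) ⟩
  1ℚ * c + fromℕ k * c     ≡⟨ ℚ.*-distribʳ-+ c 1ℚ (fromℕ k) ⟨
  (1ℚ + fromℕ k) * c       ≡⟨ cong (λ z → z * c) (fromℕ-+ 1 k) ⟨
  fromℕ (suc k) * c        ∎
  where open ≡-Reasoning

1/k*k : ∀ k → (+ 1 / suc k) * fromℕ (suc k) ≡ 1ℚ
1/k*k k = ℚ.toℚᵘ-injective (begin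
  toℚᵘ ((+ 1 / suc k) * fromℕ (suc k))        ≈⟨ ℚ.toℚᵘ-homo-* (+ 1 / suc k) (fromℕ (suc k)) ⟩
  toℚᵘ (+ 1 / suc k) ℚᵘ.* toℚᵘ (fromℕ (suc k)) ≈⟨ ℚᵘ.*-cong (toℚᵘ-/ 1 k) (toℚᵘ-/ (suc k) 0) ⟩
  mkℚᵘ (+ 1) k ℚᵘ.* mkℚᵘ (+ suc k) 0           ≈⟨ ℚᵘ.*-inverseˡ (mkℚᵘ (+ suc k) 0) ⟩
  toℚᵘ 1ℚ ∎)
  where open ℚᵘ.≃-Reasoning

*-avg-id : ∀ k (f : Vector ℚ (suc k)) → fromℕ (suc k) * avg k f ≡ sumℚ f
*-avg-id k f = begin
  fromℕ (suc k) * ((+ 1 / suc k) * sumℚ f)  ≡⟨ ℚ.*-assoc (fromℕ (suc k)) (+ 1 / suc k) (sumℚ f) ⟨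
  (fromℕ (suc k) * (+ 1 / suc k)) * sumℚ f  ≡⟨ cong (λ z → z * sumℚ f) (trans (ℚ.*-comm (fromℕ (suc k)) (+ 1 / suc k)) (1/k*k k)) ⟩
  1ℚ * sumℚ f                               ≡⟨ ℚ.*-identityˡ (sumℚ f) ⟩
  sumℚ f ∎
  where open ≡-Reasoning

avg-const : ∀ k c → avg k (λ _ → c) ≡ c
avg-const k c = begin
  u * sumℚ {suc k} (λ _ → c)  ≡⟨ cong (_*_ u) (sumℚ-const (suc k) c) ⟩
  u * (fromℕ (suc k) * c)     ≡⟨ ℚ.*-assoc u (fromℕ (suc k)) c ⟨
  (u * fromℕ (suc k)) * c     ≡⟨ cong (λ z → z * c) (1/k*k k) ⟩
  1ℚ * c                      ≡⟨ ℚ.*-identityˡ c ⟩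
  c ∎
  where open ≡-Reasoning
        u = + 1 / suc k

sum-avg : (f : Fin r → Vector ℚ (suc k)) →
          sumℚ (λ t → avg k (f t)) ≡ avg k (λ x → sumℚ (λ t → f t x))
sum-avg {k = k} f = trans (sym (∑ℚ.*-distribˡ-sum (+ 1 / suc k) (sumℚ ∘ f)))
                          (cong (_*_ (+ 1 / suc k)) (∑ℚ.∑-comm f))

avg₂ : (n m : ℕ) → Matrix ℚ (suc n) (suc m) → ℚ
avg₂ n m f = avg n (λ i → avg m (f i))

avg₂-cong : {f g : Matrix ℚ (suc n) (suc m)} → (∀ i j → f i j ≡ g i j) → avg₂ n m f ≡ avg₂ n m g
avg₂-cong f≗g = avg-cong (λ i → avg-cong (f≗g i))

avg₂-mono : {f g : Matrix ℚ (suc n) (suc m)} → (∀ i j → f i j ≤ g i j) → avg₂ n m f ≤ avg₂ n m g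
avg₂-mono f≤g = avg-mono (λ i → avg-mono (f≤g i))

avg₂-+ : (f g : Matrix ℚ (suc n) (suc m)) → avg₂ n m (λ i j → f i j + g i j) ≡ avg₂ n m f + avg₂ n m g
avg₂-+ f g = trans (avg-cong (λ i → avg-+ (f i) (g i))) (avg-+ (λ i → avg _ (f i)) (λ i → avg _ (g i)))

*-avg₂ : (c : ℚ) (f : Matrix ℚ (suc n) (suc m)) → c * avg₂ n m f ≡ avg₂ n m (λ i j → c * f i j)
*-avg₂ c f = trans (*-avg c (λ i → avg _ (f i))) (avg-cong (λ i → *-avg c (f i)))

avg₂-const : ∀ n m c → avg₂ n m (λ _ _ → c) ≡ c
avg₂-const n m c = trans (avg-const n (avg m (λ _ → c))) (avg-const m c)

sum-avg₂ : (f : Fin k → Matrix ℚ (suc n) (suc m)) →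
           sumℚ (λ t → avg₂ n m (f t)) ≡ avg₂ n m (λ i j → sumℚ (λ t → f t i j))
sum-avg₂ f = trans (sum-avg (λ t i → avg _ (f t i))) (avg-cong (λ i → sum-avg (λ t → f t i)))

mismatch : ℕ → ℕ → ℕ
mismatch a b = if does (a ℕ.≟ b) then 0 else 1

mismatch-sym : ∀ a b → mismatch a b ≡ mismatch b a
mismatch-sym zero    zero    = refl
mismatch-sym zero    (suc b) = refl
mismatch-sym (suc a) zero    = refl
mismatch-sym (suc a) (suc b) = mismatch-sym a b

mismatch-triangle : ∀ a b c → mismatch a c ℕ.≤ mismatch a b ℕ.+ mismatch b c
mismatch-triangle zero    b       zero    = ℕ.z≤n
mismatch-triangle zero    zero    (suc c) = ℕ.≤-refl
mismatch-triangle zero    (suc b) (suc c) = ℕ.s≤s ℕ.z≤n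
mismatch-triangle (suc a) zero    zero    = ℕ.≤-refl
mismatch-triangle (suc a) (suc b) zero    = ℕ.m≤n+m 1 (mismatch a b)
mismatch-triangle (suc a) zero    (suc c) = ℕ.≤-trans (bit≤1 (a ℕ.≡ᵇ c)) (ℕ.s≤s ℕ.z≤n)
  where
  bit≤1 : ∀ x → (if x then 0 else 1) ℕ.≤ 1
  bit≤1 true  = ℕ.z≤n
  bit≤1 false = ℕ.≤-refl
mismatch-triangle (suc a) (suc b) (suc c) = mismatch-triangle a b c

mismatch-bit : ∀ a b → mismatch (bit a) (bit b) ≡ bit (a xor b)
mismatch-bit true  true  = refl
mismatch-bit true  false = refl
mismatch-bit false true  = refl
mismatch-bit false false = refl

/-split : ∀ n m w → + w / (suc n ℕ.* suc m) ≡ (+ 1 / suc n) * ((+ 1 / suc m) * fromℕ w)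
/-split n m w = sym (begin
  (+ 1 / suc n) * ((+ 1 / suc m) * fromℕ w)     ≡⟨ ℚ.*-assoc (+ 1 / suc n) (+ 1 / suc m) (fromℕ w) ⟨
  ((+ 1 / suc n) * (+ 1 / suc m)) * fromℕ w     ≡⟨ cong (λ z → z * fromℕ w) (/-*-/ 1 n 1 m) ⟩
  (+ 1 / (suc n ℕ.* suc m)) * fromℕ w           ≡⟨ /-*-/ 1 (m ℕ.+ n ℕ.* suc m) w 0 ⟩
  + (1 ℕ.* w) / ((suc n ℕ.* suc m) ℕ.* 1)       ≡⟨ ℚ./-cong {+ (1 ℕ.* w)} {(suc n ℕ.* suc m) ℕ.* 1} {+ w} {suc n ℕ.* suc m}
                                                     (cong +_ (ℕ.*-identityˡ w)) (ℕ.*-identityʳ (suc n ℕ.* suc m)) ⟩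
  + w / (suc n ℕ.* suc m)                       ∎)
  where open ≡-Reasoning

-- Reads the distance as the expected mismatch at a uniform position, the form in which it meets the
-- sampling.
dist-avg : (N N′ : Matrix ℕ (suc n) (suc m)) →
           dist N N′ ≡ avg₂ n m (λ i j → fromℕ (mismatch (N i j) (N′ i j)))
dist-avg {n} {m} N N′ = begin
  dist N N′
    ≡⟨ /-split n m w ⟩
  u * (v * fromℕ w)
    ≡⟨ cong (λ z → u * (v * z)) (trans (fromℕ-sum (λ i → sumℕ (μ i))) (∑ℚ.sum-cong-≗ (λ i → fromℕ-sum (μ i)))) ⟩
  u * (v * sumℚ (λ i → sumℚ (fromℕ ∘ μ i)))
    ≡⟨ cong (_*_ u) (∑ℚ.*-distribˡ-sum v (λ i → sumℚ (fromℕ ∘ μ i))) ⟩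
  avg₂ n m (λ i j → fromℕ (μ i j)) ∎
  where
  open ≡-Reasoning
  μ = λ i j → mismatch (N i j) (N′ i j)
  w = mismatches N N′
  u = + 1 / suc n
  v = + 1 / suc m

-- Matrices are functions and are compared entrywise, so invariance under pointwise equality is
-- proved rather than obtained by substitution.
dist-cong : {N N₁ N′ N₁′ : Matrix ℕ (suc n) (suc m)} →
            (∀ i j → N i j ≡ N₁ i j) → (∀ i j → N′ i j ≡ N₁′ i j) → dist N N′ ≡ dist N₁ N₁′
dist-cong {N = N} {N₁} {N′} {N₁′} N≗ N′≗ = begin
  dist N N′    ≡⟨ dist-avg N N′ ⟩
  _            ≡⟨ avg₂-cong (λ i j → cong₂ (λ a b → fromℕ (mismatch a b)) (N≗ i j) (N′≗ i j)) ⟩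
  _            ≡⟨ dist-avg N₁ N₁′ ⟨
  dist N₁ N₁′  ∎
  where open ≡-Reasoning

dist-sym : (N N′ : Matrix ℕ (suc n) (suc m)) → dist N N′ ≡ dist N′ N
dist-sym N N′ = begin
  dist N N′  ≡⟨ dist-avg N N′ ⟩
  _          ≡⟨ avg₂-cong (λ i j → cong fromℕ (mismatch-sym (N i j) (N′ i j))) ⟩
  _          ≡⟨ dist-avg N′ N ⟨
  dist N′ N  ∎
  where open ≡-Reasoning

dist-triangle : (X Y Z : Matrix ℕ (suc n) (suc m)) → dist X Z ≤ dist X Y + dist Y Z
dist-triangle {n} {m} X Y Z = begin
  dist X Z
    ≡⟨ dist-avg X Z ⟩
  avg₂ n m (δ X Z)
    ≤⟨ avg₂-mono (λ i j → ℚ.≤-trans (fromℕ-mono (mismatch-triangle (X i j) (Y i j) (Z i j)))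
                                    (ℚ.≤-reflexive (fromℕ-+ (mismatch (X i j) (Y i j)) _))) ⟩
  avg₂ n m (λ i j → δ X Y i j + δ Y Z i j)
    ≡⟨ avg₂-+ (δ X Y) (δ Y Z) ⟩
  avg₂ n m (δ X Y) + avg₂ n m (δ Y Z)
    ≡⟨ cong₂ _+_ (dist-avg X Y) (dist-avg Y Z) ⟨
  dist X Y + dist Y Z ∎
  where
  open ℚ.≤-Reasoning
  δ = λ N N′ i j → fromℕ (mismatch (N i j) (N′ i j))

-- Rounding to a binary factorization

-- Matrices are searched through bit vectors, where existence is decidable.
decode : Subset (n ℕ.* m) → BinMatrix n m
decode v i j = Vec.lookup v (combine i j)

encode : BinMatrix n m → Subset (n ℕ.* m)
encode {m = m} A = Vec.tabulate (uncurry A ∘ remQuot m)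

decode-encode : (A : BinMatrix n m) → ∀ i j → decode (encode A) i j ≡ A i j
decode-encode {m = m} A i j =
  trans (Vec.lookup∘tabulate (uncurry A ∘ remQuot m) (combine i j)) (cong (uncurry A) (remQuot-combine i j))

approximates-resp :
  (N : BinMatrix (suc n) (suc m)) (δ : ℚ)
  {A A′ : BinMatrix (suc n) d} {B B′ : BinMatrix d (suc m)} →
  (∀ i j → (A · B) i j ≡ (A′ · B′) i j) → Approximates N δ (A , B) → Approximates N δ (A′ , B′)
approximates-resp N δ {A} {A′} {B} {B′} eq (is01 , close) =
  (λ i j → subst (λ z → z ≡ 0 ⊎ z ≡ 1) (eq i j) (is01 i j)) ,
  subst (_≤ δ) (dist-cong {N = ⟦ N ⟧} {N′ = A · B} (λ _ _ → refl) eq) close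

Rounding : (d : ℕ) → ℚ → BinMatrix (suc n) (suc m) → Set
Rounding {n} {m} d δ N =
  ∃[ p ] ∃[ q ] Approximates {d = d} N δ (decode {suc n} {d} p , decode {d} {suc m} q)

rounding? : ∀ d δ (N : BinMatrix (suc n) (suc m)) → Dec (Rounding d δ N)
rounding? d δ N = anySubset? λ p → anySubset? λ q → approximates? N δ (decode p , decode q)

extract : ∀ d δ (N : BinMatrix (suc n) (suc m)) →
          Dec (Rounding d δ N) → BinMatrix (suc n) d × BinMatrix d (suc m)
extract d δ N (yes (p , q , _)) = decode p , decode q
-- An arbitrary default; it cannot occur when some factorization is δ-close to N.
extract d δ N (no _)            = (λ _ _ → false) , (λ _ _ → false)

-- The search covers all pairs of matrices up to pointwise equality, so a single good pair rules out
-- the `no` case.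
extract-approximates : ∀ (δ : ℚ) (N : BinMatrix (suc n) (suc m)) {A : BinMatrix (suc n) d} {B} →
                       Approximates N δ (A , B) → (dec : Dec (Rounding d δ N)) →
                       Approximates N δ (extract d δ N dec)
extract-approximates δ N AB≈N (yes (p , q , pq≈N)) = pq≈N
extract-approximates δ N {A} {B} AB≈N (no ∄) =
  contradiction (encode A , encode B ,
    approximates-resp N δ {A} {decode (encode A)} {B} {decode (encode B)} decoded AB≈N) ∄
  where
  decoded : ∀ i j → (A · B) i j ≡ (decode (encode A) · decode (encode B)) i j
  decoded i j = sumℕ-cong (λ k → cong₂ (λ a b → bit a ℕ.* bit b)
                                       (sym (decode-encode A i k)) (sym (decode-encode B k j)))

round : ∀ d (δ : ℚ) → BinMatrix (suc n) (suc m) → BinMatrix (suc n) d × BinMatrix d (suc m)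
round d δ N = extract d δ N (rounding? d δ N)

bit-01 : ∀ b → bit b ≡ 0 ⊎ bit b ≡ 1
bit-01 true  = inj₂ refl
bit-01 false = inj₁ refl

-- The given factorization of M is itself a candidate within ε of N, so the search succeeds. The
-- triangle inequality through N then costs ε twice.
round-close : ∀ (ε : ℚ) (M N : BinMatrix (suc n) (suc m)) → Factors M d →
              dist ⟦ M ⟧ ⟦ N ⟧ ≤ ε → Approximates M (fromℕ 2 * ε) (round d ε N)
round-close {d = d} ε M N (A , B , M≗AB) M≈N = proj₁ rounded , (begin
  dist ⟦ M ⟧ (A′ · B′)                        ≤⟨ dist-triangle ⟦ M ⟧ ⟦ N ⟧ (A′ · B′) ⟩
  dist ⟦ M ⟧ ⟦ N ⟧ + dist ⟦ N ⟧ (A′ · B′)     ≤⟨ ℚ.+-mono-≤ M≈N (proj₂ rounded) ⟩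
  ε + ε                                       ≡⟨ solve 1 (λ e → e :+ e := con (fromℕ 2) :* e) refl ε ⟩
  fromℕ 2 * ε                                 ∎)
  where
  open ℚ.≤-Reasoning
  open +-*-Solver using (solve; _:=_; _:+_; _:*_; con)
  A′ = proj₁ (round d ε N)
  B′ = proj₂ (round d ε N)
  rounded : Approximates N ε (round d ε N)
  rounded = extract-approximates ε N {A} {B}
    ( (λ i j → subst (λ z → z ≡ 0 ⊎ z ≡ 1) (M≗AB i j) (bit-01 (M i j)))
    , subst (_≤ ε) (trans (dist-sym ⟦ M ⟧ ⟦ N ⟧) (dist-cong {N = ⟦ N ⟧} (λ _ _ → refl) M≗AB)) M≈N )
    (rounding? d ε N)

-- The algorithm

queryAll : Vector (Fin n × Fin m) k → (Vector Bool k → Algorithm n m O) → Algorithm n m O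
queryAll {k = zero}  ps f = f (λ ())
queryAll {k = suc k} ps f = query (proj₁ (ps zero)) (proj₂ (ps zero)) (λ b → queryAll (ps ∘ suc) (f ∘ (b ∷_)))

-- Assembled with `∷` exactly as `queryAll` assembles its answers, so the continuation receives
-- literally the same function and no extensionality is required.
answers : BinMatrix n m → Vector (Fin n × Fin m) k → Vector Bool k
answers {k = zero}  M ps = λ ()
answers {k = suc k} M ps = uncurry M (ps zero) ∷ answers M (ps ∘ suc)

answers-correct : (M : BinMatrix n m) (ps : Vector (Fin n × Fin m) k) → answers M ps ≗ uncurry M ∘ ps
answers-correct M ps zero    = refl
answers-correct M ps (suc x) = answers-correct M (ps ∘ suc) x

Pr-queryAll : ∀ {P : Pred O 0ℓ} (P? : Decidable P) (M : BinMatrix n m)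
              (ps : Vector (Fin n × Fin m) k) (f : Vector Bool k → Algorithm n m O) →
              Pr P? (queryAll ps f) M ≡ Pr P? (f (answers M ps)) M
Pr-queryAll {k = zero}  P? M ps f = refl
Pr-queryAll {k = suc k} P? M ps f = Pr-queryAll P? M (ps ∘ suc) (f ∘ (uncurry M (ps zero) ∷_))

queries-queryAll : (M : BinMatrix n m) (ps : Vector (Fin n × Fin m) k)
                   (f : Vector Bool k → Algorithm n m O) →
                   queries (queryAll ps f) M ≡ k ℕ.+ queries (f (answers M ps)) M
queries-queryAll {k = zero}  M ps f = refl
queries-queryAll {k = suc k} M ps f =
  cong suc (queries-queryAll M (ps ∘ suc) (f ∘ (uncurry M (ps zero) ∷_)))

residual : BinMatrix n m → BinMatrix n m → BinMatrix n m
residual M N i j = M i j xor N i j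

column : Fin m → Vector (Fin n × Fin m) n
column j i = i , j

row : Fin n → Vector (Fin n × Fin m) m
row i j = i , j

-- Here u and v stand for column j and row i of M. Adding the known entries of N turns them into the
-- column and row of the residual, whose product is added to N.
eliminate : Fin n → Fin m → Vector Bool n → Vector Bool m → BinMatrix n m → BinMatrix n m
eliminate i j u v N s c = N s c xor ((u s xor N s j) ∧ (v c xor N i c))

-- The effect of one sample as seen by the analysis, which knows M; the algorithm produces it
-- through queries in `branch`.
step : BinMatrix n m → BinMatrix n m → Fin n → Fin m → BinMatrix n m
step M N i j =
  if residual M N i j then eliminate i j (answers M (column j)) (answers M (row i)) N else N

RankAtMost-resp : {E E′ : BinMatrix n m} → (∀ i j → E i j ≡ E′ i j) → RankAtMost r E → RankAtMost r E′
RankAtMost-resp E≗E′ (A , B , E≗AB) = A , B , λ i j → trans (sym (E≗E′ i j)) (E≗AB i j)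

residual-eliminate :
  (M N : BinMatrix n m) (i : Fin n) (j : Fin m) → ∀ s c →
  deflate i j (residual M N) s c ≡
  residual M (eliminate i j (answers M (column j)) (answers M (row i)) N) s c
residual-eliminate M N i j s c = begin
  (M s c xor N s c) xor ((M s j xor N s j) ∧ (M i c xor N i c))
    ≡⟨ xor-assoc (M s c) (N s c) _ ⟩
  M s c xor (N s c xor ((M s j xor N s j) ∧ (M i c xor N i c)))
    ≡⟨ cong₂ (λ x y → M s c xor (N s c xor ((x xor N s j) ∧ (y xor N i c))))
             (answers-correct M (column j) s) (answers-correct M (row i) c) ⟨
  residual M (eliminate i j (answers M (column j)) (answers M (row i)) N) s c ∎
  where open ≡-Reasoning

-- The potential argument: a hit pays exactly one unit of the rank bound and a miss pays nothing.
-- Both the query count and the failure count telescope along this equation.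
step-rank : (M N : BinMatrix n m) (i : Fin n) (j : Fin m) → RankAtMost r (residual M N) →
            ∃[ r′ ] bit (residual M N i j) ℕ.+ r′ ≡ r × RankAtMost r′ (residual M (step M N i j))
step-rank {r = r} M N i j R with residual M N i j in Eij
... | false = r , refl , R
-- A residual of rank 0 is an empty sum in every entry, hence zero, and cannot be hit.
step-rank {r = zero}  M N i j (A , B , E≗AB) | true with () ← trans (sym Eij) (E≗AB i j)
step-rank {r = suc r} M N i j R | true =
  r , refl , RankAtMost-resp (residual-eliminate M N i j) (deflate-rank (residual M N) Eij R)

branch : (BinMatrix n m → Algorithm n m O) → BinMatrix n m → Fin n → Fin m → Bool → Algorithm n m O
branch continue N i j b =
  if b xor N i j
  then queryAll (column j) (λ u → queryAll (row i) (λ v → continue (eliminate i j u v N)))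
  else continue N

Pr-branch : ∀ {P : Pred O 0ℓ} (P? : Decidable P) (M : BinMatrix n m) continue N i j →
            Pr P? (branch continue N i j (M i j)) M ≡ Pr P? (continue (step M N i j)) M
Pr-branch P? M continue N i j with residual M N i j
... | false = refl
... | true  = trans
  (Pr-queryAll P? M (column j) (λ u → queryAll (row i) (λ v → continue (eliminate i j u v N))))
  (Pr-queryAll P? M (row i) (λ v → continue (eliminate i j (answers M (column j)) v N)))

queries-branch : ∀ (M : BinMatrix n m) (continue : BinMatrix n m → Algorithm n m O) N i j →
                 queries (branch continue N i j (M i j)) M ≡
                 bit (residual M N i j) ℕ.* (n ℕ.+ m) ℕ.+ queries (continue (step M N i j)) M
queries-branch {n} {m} M continue N i j with residual M N i j
... | false = refl
... | true  = begin
  queries (queryAll (column j) (λ u → queryAll (row i) (λ v → continue (eliminate i j u v N)))) M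
    ≡⟨ queries-queryAll M (column j) (λ u → queryAll (row i) (λ v → continue (eliminate i j u v N))) ⟩
  n ℕ.+ queries (queryAll (row i) (λ v → continue (eliminate i j (answers M (column j)) v N))) M
    ≡⟨ cong (n ℕ.+_) (queries-queryAll M (row i) (λ v → continue (eliminate i j (answers M (column j)) v N))) ⟩
  n ℕ.+ (m ℕ.+ q)
    ≡⟨ ℕ.+-assoc n m q ⟨
  (n ℕ.+ m) ℕ.+ q
    ≡⟨ cong (ℕ._+ q) (ℕ.*-identityˡ (n ℕ.+ m)) ⟨
  1 ℕ.* (n ℕ.+ m) ℕ.+ q ∎
  where
  open ≡-Reasoning
  q = queries (continue (eliminate i j (answers M (column j)) (answers M (row i)) N)) M

foldr-⊔-≤ : ∀ {b} (f : Vector ℕ k) → (∀ x → f x ℕ.≤ b) → foldr ℕ._⊔_ 0 f ℕ.≤ b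
foldr-⊔-≤ {zero}  f f≤b = ℕ.z≤n
foldr-⊔-≤ {suc k} f f≤b = ℕ.⊔-lub (f≤b zero) (foldr-⊔-≤ (f ∘ suc) (f≤b ∘ suc))

module _ (finish : BinMatrix (suc n) (suc m) → O) where

  run : ℕ → BinMatrix (suc n) (suc m) → Algorithm (suc n) (suc m) O
  run zero    N = output (finish N)
  run (suc t) N = toss n λ i → toss m λ j → query i j (branch (run t) N i j)

  Pr-run-suc : ∀ {P : Pred O 0ℓ} (P? : Decidable P) M t N →
               Pr P? (run (suc t) N) M ≡ avg₂ n m (λ i j → Pr P? (run t (step M N i j)) M)
  Pr-run-suc P? M t N =
    avg₂-cong {f = λ i j → Pr P? (branch (run t) N i j (M i j)) M}
              {g = λ i j → Pr P? (run t (step M N i j)) M}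
              (Pr-branch P? M (run t) N)

  -- Every round queries its sampled entry. A hit costs a full row and column more, but it uses up a
  -- unit of rank, so there are at most r hits.
  queries-run : ∀ {r} M t N → RankAtMost r (residual M N) →
                queries (run t N) M ℕ.≤ t ℕ.+ r ℕ.* (suc n ℕ.+ suc m)
  queries-run     M zero    N R = ℕ.z≤n
  queries-run {r} M (suc t) N R =
    foldr-⊔-≤ (λ i → queries (toss m λ j → query i j (branch (run t) N i j)) M) λ i →
    foldr-⊔-≤ (λ j → queries (query i j (branch (run t) N i j)) M) λ j → ℕ.s≤s (bound i j)
    where
    l = suc n ℕ.+ suc m
    bound : ∀ i j → queries (branch (run t) N i j (M i j)) M ℕ.≤ t ℕ.+ r ℕ.* l
    bound i j = let r′ , b+r′≡r , R′ = step-rank M N i j R ; b = bit (residual M N i j) in begin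
      queries (branch (run t) N i j (M i j)) M        ≡⟨ queries-branch M (run t) N i j ⟩
      b ℕ.* l ℕ.+ queries (run t (step M N i j)) M    ≤⟨ ℕ.+-monoʳ-≤ (b ℕ.* l) (queries-run M t (step M N i j) R′) ⟩
      b ℕ.* l ℕ.+ (t ℕ.+ r′ ℕ.* l)                    ≡⟨ solve 4 (λ b l t r → b :* l :+ (t :+ r :* l) := t :+ (b :+ r) :* l) refl b l t r′ ⟩
      t ℕ.+ (b ℕ.+ r′) ℕ.* l                          ≡⟨ cong (λ z → t ℕ.+ z ℕ.* l) b+r′≡r ⟩
      t ℕ.+ r ℕ.* l                                   ∎
      where
      open ℕ.≤-Reasoning
      open ℕSolver using (solve; _:=_; _:+_; _:*_)

-- Success probability with a random number of rounds

dist-residual : (M N : BinMatrix (suc n) (suc m)) →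
                dist ⟦ M ⟧ ⟦ N ⟧ ≡ avg₂ n m (λ i j → fromℕ (bit (residual M N i j)))
dist-residual M N = trans (dist-avg ⟦ M ⟧ ⟦ N ⟧) (avg₂-cong (λ i j → cong fromℕ (mismatch-bit (M i j) (N i j))))

fromℕ≥0 : ∀ k → 0ℚ ≤ fromℕ k
fromℕ≥0 k = fromℕ-mono {0} {k} ℕ.z≤n

indicator≥0 : ∀ b → 0ℚ ≤ (if b then 1ℚ else 0ℚ)
indicator≥0 true  = fromℕ≥0 1
indicator≥0 false = fromℕ≥0 0

module _ (M : BinMatrix (suc n) (suc m)) (finish : BinMatrix (suc n) (suc m) → O)
         {P : Pred O 0ℓ} (P? : Decidable P) (ε : ℚ) .{{_ : NonNegative ε}}
         (good : ∀ N → dist ⟦ M ⟧ ⟦ N ⟧ ≤ ε → P (finish N)) where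

  -- This is T times the success probability when the number of rounds is uniform in {0,...,T-1}.
  successes : ℕ → BinMatrix (suc n) (suc m) → ℚ
  successes T N = sumℚ {T} (λ t → Pr P? (run finish (toℕ t) N) M)

  -- For ε > 0 this bounds the expected number of failing stopping times among T by r / ε, with the
  -- division cleared. It ranges over all N and r because the induction passes to the state after
  -- one sample.
  FewFailures : ℕ → Set
  FewFailures T = ∀ {r} N → RankAtMost r (residual M N) → ε * fromℕ T ≤ ε * successes T N + fromℕ r

  -- Split off stopping time 0. Either N is accurate and stopping succeeds, or `D` is at least ε;
  -- both give ε ≤ ε * s₀ + D. The term `D` is then paid for by the expected drop in rank at the
  -- first sample.
  fewFailures-suc : ∀ {T} → FewFailures T → FewFailures (suc T)
  fewFailures-suc {T} IH {r} N R = begin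
    ε * fromℕ (suc T)              ≡⟨ cong (ε *_) (fromℕ-+ 1 T) ⟩
    ε * (1ℚ + fromℕ T)             ≡⟨ solve 2 (λ e t → e :* (con 1ℚ :+ t) := e :+ e :* t) refl ε (fromℕ T) ⟩
    ε + ε * fromℕ T                ≤⟨ ℚ.+-monoˡ-≤ (ε * fromℕ T) ([ accurate , inaccurate ]′ (ℚ.≤-total D ε)) ⟩
    (ε * s₀ + D) + ε * fromℕ T     ≡⟨ solve 3 (λ a b c → (a :+ b) :+ c := a :+ (c :+ b)) refl (ε * s₀) D (ε * fromℕ T) ⟩
    ε * s₀ + (ε * fromℕ T + D)     ≤⟨ ℚ.+-monoʳ-≤ (ε * s₀) continue ⟩
    ε * s₀ + (ε * S + fromℕ r)     ≡⟨ solve 4 (λ e a b c → e :* a :+ (e :* b :+ c) := e :* (a :+ b) :+ c) refl ε s₀ S (fromℕ r) ⟩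
    ε * (s₀ + S) + fromℕ r         ∎
    where
    open ℚ.≤-Reasoning
    open +-*-Solver using (solve; _:=_; _:+_; _:*_; con)
    s₀ = Pr P? (run finish 0 N) M
    S  = sumℚ {T} (λ t → Pr P? (run finish (suc (toℕ t)) N) M)
    D  = dist ⟦ M ⟧ ⟦ N ⟧
    e  = λ i j → fromℕ (bit (residual M N i j))
    g  = λ i j → successes T (step M N i j)

    D≥0 : 0ℚ ≤ D
    D≥0 = begin
      0ℚ                     ≡⟨ avg₂-const n m 0ℚ ⟨
      avg₂ n m (λ _ _ → 0ℚ)  ≤⟨ avg₂-mono (λ i j → fromℕ≥0 (bit (residual M N i j))) ⟩
      avg₂ n m e             ≡⟨ dist-residual M N ⟨
      D                      ∎

    accurate : D ≤ ε → ε ≤ ε * s₀ + D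
    accurate D≤ε = begin
      ε            ≡⟨ ℚ.*-identityʳ ε ⟨
      ε * 1ℚ       ≡⟨ cong (λ b → ε * (if b then 1ℚ else 0ℚ)) (dec-true (P? (finish N)) (good N D≤ε)) ⟨
      ε * s₀       ≡⟨ ℚ.+-identityʳ (ε * s₀) ⟨
      ε * s₀ + 0ℚ  ≤⟨ ℚ.+-monoʳ-≤ (ε * s₀) D≥0 ⟩
      ε * s₀ + D   ∎

    inaccurate : ε ≤ D → ε ≤ ε * s₀ + D
    inaccurate ε≤D = begin
      ε            ≤⟨ ε≤D ⟩
      D            ≡⟨ ℚ.+-identityˡ D ⟨
      0ℚ + D       ≡⟨ cong (_+ D) (ℚ.*-zeroʳ ε) ⟨
      ε * 0ℚ + D   ≤⟨ ℚ.+-monoˡ-≤ D (ℚ.*-monoˡ-≤-nonNeg ε (indicator≥0 (does (P? (finish N))))) ⟩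
      ε * s₀ + D   ∎

    -- The induction hypothesis is used at the new rank bound r′, and `e i j` restores exactly the
    -- unit lost in a hit.
    step-succeeds : ∀ i j → ε * fromℕ T + e i j ≤ ε * g i j + fromℕ r
    step-succeeds i j = let r′ , b+r′≡r , R′ = step-rank M N i j R in begin
      ε * fromℕ T + e i j             ≤⟨ ℚ.+-monoˡ-≤ (e i j) (IH (step M N i j) R′) ⟩
      (ε * g i j + fromℕ r′) + e i j  ≡⟨ ℚ.+-assoc (ε * g i j) (fromℕ r′) (e i j) ⟩
      ε * g i j + (fromℕ r′ + e i j)  ≡⟨ cong (_+_ (ε * g i j)) (ℚ.+-comm (fromℕ r′) (e i j)) ⟩
      ε * g i j + (e i j + fromℕ r′)  ≡⟨ cong (_+_ (ε * g i j)) (fromℕ-+ (bit (residual M N i j)) r′) ⟨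
      ε * g i j + fromℕ (bit (residual M N i j) ℕ.+ r′)  ≡⟨ cong (λ z → ε * g i j + fromℕ z) b+r′≡r ⟩
      ε * g i j + fromℕ r             ∎

    S≡avg : S ≡ avg₂ n m g
    S≡avg = trans (∑ℚ.sum-cong-≗ {T} {λ t → Pr P? (run finish (suc (toℕ t)) N) M} {λ t → avg₂ n m (p t)}
                                 (λ t → Pr-run-suc finish P? M (toℕ t) N))
                  (sum-avg₂ p)
      where
      p : Fin T → Matrix ℚ (suc n) (suc m)
      p t i j = Pr P? (run finish (toℕ t) (step M N i j)) M

    -- Average `step-succeeds` over the sampled position; the mean of `e` is the hit probability
    -- `D`.
    continue : ε * fromℕ T + D ≤ ε * S + fromℕ r
    continue = begin
      ε * fromℕ T + D
        ≡⟨ cong₂ _+_ (sym (avg₂-const n m (ε * fromℕ T))) (dist-residual M N) ⟩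
      avg₂ n m (λ _ _ → ε * fromℕ T) + avg₂ n m e
        ≡⟨ avg₂-+ (λ _ _ → ε * fromℕ T) e ⟨
      avg₂ n m (λ i j → ε * fromℕ T + e i j)
        ≤⟨ avg₂-mono step-succeeds ⟩
      avg₂ n m (λ i j → ε * g i j + fromℕ r)
        ≡⟨ avg₂-+ (λ i j → ε * g i j) (λ _ _ → fromℕ r) ⟩
      avg₂ n m (λ i j → ε * g i j) + avg₂ n m (λ _ _ → fromℕ r)
        ≡⟨ cong₂ _+_ (sym (*-avg₂ ε g)) (avg₂-const n m (fromℕ r)) ⟩
      ε * avg₂ n m g + fromℕ r
        ≡⟨ cong (λ z → ε * z + fromℕ r) S≡avg ⟨
      ε * S + fromℕ r ∎

  -- A sampled position is an error with probability dist M N, and each error found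
  -- uses up one unit of rank; so the expected number of rounds entered with
  -- dist M N > ε is at most r / ε.
  fewFailures : ∀ T → FewFailures T
  fewFailures zero {r} N R = begin
    ε * 0ℚ            ≡⟨ ℚ.+-identityʳ (ε * 0ℚ) ⟨
    ε * 0ℚ + 0ℚ       ≤⟨ ℚ.+-monoʳ-≤ (ε * 0ℚ) (fromℕ≥0 r) ⟩
    ε * 0ℚ + fromℕ r  ∎
    where open ℚ.≤-Reasoning
  fewFailures (suc T) = fewFailures-suc {T} (fewFailures T)

-- The number of samples

-- 1 + ⌊1/ε⌋; the numerator p of ε is written suc (pred p) because ε ranges over all of ℚ.
⌊1/_⌋+1 : ℚ → ℕ
⌊1/ ε ⌋+1 = suc (↧ₙ ε ℕ./ suc (ℕ.pred ℤ.∣ ↥ ε ∣))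

toℚᵘ-*-fromℕ : ∀ ε k → toℚᵘ (ε * fromℕ k) ℚᵘ.≃ toℚᵘ ε ℚᵘ.* mkℚᵘ (+ k) 0
toℚᵘ-*-fromℕ ε k = ℚᵘ.≃-trans (ℚ.toℚᵘ-homo-* ε (fromℕ k)) (ℚᵘ.*-congˡ {toℚᵘ ε} (toℚᵘ-/ k 0))

n≤m*[1+n/m] : ∀ n m .{{_ : NonZero m}} → n ℕ.≤ m ℕ.* suc (n ℕ./ m)
n≤m*[1+n/m] n m = begin
  n                             ≡⟨ ℕ.m≡m%n+[m/n]*n n m ⟩
  n ℕ.% m ℕ.+ n ℕ./ m ℕ.* m     ≤⟨ ℕ.+-monoˡ-≤ (n ℕ./ m ℕ.* m) (ℕ.<⇒≤ (ℕ.m%n<n n m)) ⟩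
  suc (n ℕ./ m) ℕ.* m           ≡⟨ ℕ.*-comm (suc (n ℕ./ m)) m ⟩
  m ℕ.* suc (n ℕ./ m)           ∎
  where open ℕ.≤-Reasoning

m*[1+n/m]≤2*n : ∀ {n m} .{{_ : NonZero m}} → m ℕ.≤ n → m ℕ.* suc (n ℕ./ m) ℕ.≤ 2 ℕ.* n
m*[1+n/m]≤2*n {n} {m} m≤n = begin
  m ℕ.* suc (n ℕ./ m)           ≡⟨ ℕ.*-comm m (suc (n ℕ./ m)) ⟩
  m ℕ.+ n ℕ./ m ℕ.* m           ≤⟨ ℕ.+-mono-≤ m≤n (ℕ.m/n*n≤m n m) ⟩
  n ℕ.+ n                       ≡⟨ cong (n ℕ.+_) (ℕ.+-identityʳ n) ⟨
  2 ℕ.* n                       ∎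
  where open ℕ.≤-Reasoning

1≤ε*⌊1/ε⌋+1 : ∀ (ε : ℚ) .{{_ : Positive ε}} → 1ℚ ≤ ε * fromℕ ⌊1/ ε ⌋+1
1≤ε*⌊1/ε⌋+1 ε@(mkℚ (+ suc p) q _) = ℚ.toℚᵘ-cancel-≤ (begin
  toℚᵘ 1ℚ                              ≤⟨ ℚᵘ.*≤* (ℤ.+≤+ bound) ⟩
  mkℚᵘ (+ suc p) q ℚᵘ.* mkℚᵘ (+ K) 0   ≃⟨ toℚᵘ-*-fromℕ ε K ⟨
  toℚᵘ (ε * fromℕ K)                   ∎)
  where
  K = ⌊1/ ε ⌋+1
  bound : 1 ℕ.* (suc q ℕ.* 1) ℕ.≤ (suc p ℕ.* K) ℕ.* 1
  bound = begin
    1 ℕ.* (suc q ℕ.* 1)   ≡⟨ trans (ℕ.*-identityˡ (suc q ℕ.* 1)) (ℕ.*-identityʳ (suc q)) ⟩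
    suc q                 ≤⟨ n≤m*[1+n/m] (suc q) (suc p) ⟩
    suc p ℕ.* K           ≡⟨ ℕ.*-identityʳ (suc p ℕ.* K) ⟨
    (suc p ℕ.* K) ℕ.* 1   ∎
    where open ℕ.≤-Reasoning
  open ℚᵘ.≤-Reasoning

-- Since 1 ≤ 1/ε, the rounded value 1 + ⌊1/ε⌋ is at most 2/ε.
ε*⌊1/ε⌋+1≤2 : ∀ (ε : ℚ) .{{_ : Positive ε}} → ε ≤ 1ℚ → ε * fromℕ ⌊1/ ε ⌋+1 ≤ fromℕ 2
ε*⌊1/ε⌋+1≤2 ε@(mkℚ (+ suc p) q _) (*≤* p*1≤1*q) = ℚ.toℚᵘ-cancel-≤ (begin
  toℚᵘ (ε * fromℕ K)                   ≃⟨ toℚᵘ-*-fromℕ ε K ⟩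
  mkℚᵘ (+ suc p) q ℚᵘ.* mkℚᵘ (+ K) 0   ≤⟨ ℚᵘ.*≤* (ℤ.+≤+ bound) ⟩
  toℚᵘ (fromℕ 2)                       ∎)
  where
  K = ⌊1/ ε ⌋+1
  p≤q : suc p ℕ.≤ suc q
  p≤q = ℤ.drop‿+≤+ (subst₂ ℤ._≤_ (ℤ.*-identityʳ (+ suc p)) (ℤ.*-identityˡ (+ suc q)) p*1≤1*q)
  bound : (suc p ℕ.* K) ℕ.* 1 ℕ.≤ 2 ℕ.* (suc q ℕ.* 1)
  bound = begin
    (suc p ℕ.* K) ℕ.* 1   ≡⟨ ℕ.*-identityʳ (suc p ℕ.* K) ⟩
    suc p ℕ.* K           ≤⟨ m*[1+n/m]≤2*n p≤q ⟩
    2 ℕ.* suc q           ≡⟨ cong (2 ℕ.*_) (ℕ.*-identityʳ (suc q)) ⟨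
    2 ℕ.* (suc q ℕ.* 1)   ∎
    where open ℕ.≤-Reasoning
  open ℚᵘ.≤-Reasoning

-- Dividing by w would give x ≥ 1 - s/w ≥ 1 - 1/6; the computation instead multiplies through by 6
-- and w and cancels.
5/6≤ : ∀ (w x : ℚ) (s : ℕ) .{{_ : Positive w}} → fromℕ (6 ℕ.* s) ≤ w → w ≤ w * x + fromℕ s → + 5 / 6 ≤ x
5/6≤ w x s 6s≤w w≤wx+s = ℚ.*-cancelˡ-≤-pos (fromℕ 6) (ℚ.*-cancelˡ-≤-pos w (begin
  w * (fromℕ 6 * (+ 5 / 6))                     ≡⟨ solve 1 (λ a → a :* (con (fromℕ 6) :* con (+ 5 / 6)) := con (fromℕ 6) :* a :- a) refl w ⟩
  fromℕ 6 * w - w                               ≤⟨ ℚ.+-monoˡ-≤ (- w) (ℚ.*-monoˡ-≤-nonNeg (fromℕ 6) w≤wx+s) ⟩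
  fromℕ 6 * (w * x + fromℕ s) - w               ≡⟨ solve 3 (λ a b c → con (fromℕ 6) :* (a :* b :+ c) :- a := a :* (con (fromℕ 6) :* b) :+ (con (fromℕ 6) :* c :- a)) refl w x (fromℕ s) ⟩
  w * (fromℕ 6 * x) + (fromℕ 6 * fromℕ s - w)   ≡⟨ cong (λ z → w * (fromℕ 6 * x) + (z - w)) (fromℕ-* 6 s) ⟨
  w * (fromℕ 6 * x) + (fromℕ (6 ℕ.* s) - w)     ≤⟨ ℚ.+-monoʳ-≤ (w * (fromℕ 6 * x)) (ℚ.+-monoˡ-≤ (- w) 6s≤w) ⟩
  w * (fromℕ 6 * x) + (w - w)                   ≡⟨ solve 2 (λ a b → b :+ (a :- a) := b) refl w (w * (fromℕ 6 * x)) ⟩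
  w * (fromℕ 6 * x)                             ∎))
  where
  open ℚ.≤-Reasoning
  open +-*-Solver using (solve; _:=_; _:+_; _:*_; _:-_; con)

5/6≤avg : ∀ d (ε : ℚ) .{{_ : Positive ε}} (f : Vector ℚ (suc k)) →
          fromℕ (6 ℕ.* d) ≤ ε * fromℕ (suc k) →
          ε * fromℕ (suc k) ≤ ε * sumℚ f + fromℕ d → + 5 / 6 ≤ avg k f
5/6≤avg {k} d ε f 6d≤w w≤Σ+d = 5/6≤ w (avg k f) d {{w>0}} 6d≤w (begin
  w                                        ≤⟨ w≤Σ+d ⟩
  ε * sumℚ f + fromℕ d                     ≡⟨ cong (λ z → ε * z + fromℕ d) (*-avg-id k f) ⟨
  ε * (fromℕ (suc k) * avg k f) + fromℕ d  ≡⟨ cong (_+ fromℕ d) (ℚ.*-assoc ε (fromℕ (suc k)) (avg k f)) ⟨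
  w * avg k f + fromℕ d                    ∎)
  where
  open ℚ.≤-Reasoning
  w = ε * fromℕ (suc k)
  w>0 : Positive w
  w>0 = ℚ.pos*pos⇒pos ε (fromℕ (suc k)) {{ℚ.normalize-pos (suc k) 1}}

-- The failure probability is at most d / (ε T) for T stopping times; the factor 6 brings this down
-- to 1/6.
rounds : ℕ → ℚ → ℕ
rounds d ε = 6 ℕ.* d ℕ.* ⌊1/ ε ⌋+1

rounds-enough : ∀ d (ε : ℚ) .{{_ : Positive ε}} → fromℕ (6 ℕ.* d) ≤ ε * fromℕ (suc (rounds d ε))
rounds-enough d ε = begin
  s                             ≡⟨ ℚ.*-identityʳ s ⟨
  s * 1ℚ                        ≤⟨ ℚ.*-monoˡ-≤-nonNeg s {{nonNegative (fromℕ≥0 (6 ℕ.* d))}} (1≤ε*⌊1/ε⌋+1 ε) ⟩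
  s * (ε * fromℕ K)             ≡⟨ solve 3 (λ a b c → a :* (b :* c) := b :* (a :* c)) refl s ε (fromℕ K) ⟩
  ε * (s * fromℕ K)             ≡⟨ cong (ε *_) (fromℕ-* (6 ℕ.* d) K) ⟨
  ε * fromℕ (rounds d ε)        ≤⟨ ℚ.*-monoˡ-≤-nonNeg ε {{ℚ.pos⇒nonNeg ε}} (fromℕ-mono (ℕ.n≤1+n (rounds d ε))) ⟩
  ε * fromℕ (suc (rounds d ε))  ∎
  where
  open ℚ.≤-Reasoning
  open +-*-Solver using (solve; _:=_; _:*_)
  K = ⌊1/ ε ⌋+1
  s = fromℕ (6 ℕ.* d)

-- Lets the O(d/ε) samples be absorbed by the second term of `complexity`. The logarithm is at least
-- 1 because d + 1 ≥ 2.
d≤d³log : ∀ d → 1 ℕ.≤ d → d ℕ.≤ d ℕ.^ 3 ℕ.* ⌈log₂ suc d ⌉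
d≤d³log d@(suc _) 1≤d = begin
  d                              ≡⟨ ℕ.*-identityʳ d ⟨
  d ℕ.* 1                        ≤⟨ ℕ.*-monoʳ-≤ d (ℕ.m^n>0 d 2) ⟩
  d ℕ.^ 3                        ≡⟨ ℕ.*-identityʳ (d ℕ.^ 3) ⟨
  d ℕ.^ 3 ℕ.* 1                  ≤⟨ ℕ.*-monoʳ-≤ (d ℕ.^ 3) (⌈log₂⌉-mono-≤ (ℕ.s≤s 1≤d)) ⟩
  d ℕ.^ 3 ℕ.* ⌈log₂ suc d ⌉      ∎
  where open ℕ.≤-Reasoning

-- One factor ε cancels against 1 + ⌊1/ε⌋ up to 2, giving 12 = 6 · 2; the other is bounded by 1.
rounds-few : ∀ d → 1 ℕ.≤ d → ∀ (ε : ℚ) .{{_ : Positive ε}} → ε ≤ 1ℚ →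
             fromℕ (rounds d ε) * (ε * ε) ≤ fromℕ 12 * fromℕ (d ℕ.^ 3 ℕ.* ⌈log₂ suc d ⌉)
rounds-few d 1≤d ε ε≤1 = begin
  fromℕ (6 ℕ.* d ℕ.* K) * (ε * ε)             ≡⟨ cong (λ z → z * (ε * ε)) (fromℕ-* (6 ℕ.* d) K) ⟩
  fromℕ (6 ℕ.* d) * fromℕ K * (ε * ε)         ≡⟨ solve 3 (λ a k e → a :* k :* (e :* e) := (a :* (e :* k)) :* e) refl s (fromℕ K) ε ⟩
  s * (ε * fromℕ K) * ε                       ≤⟨ ℚ.*-monoʳ-≤-nonNeg ε {{ℚ.pos⇒nonNeg ε}} (ℚ.*-monoˡ-≤-nonNeg s {{nonNegative (fromℕ≥0 (6 ℕ.* d))}} (ε*⌊1/ε⌋+1≤2 ε ε≤1)) ⟩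
  s * fromℕ 2 * ε                             ≡⟨ cong (λ z → z * ε) (fromℕ-* (6 ℕ.* d) 2) ⟨
  s₂ * ε                                      ≤⟨ ℚ.*-monoˡ-≤-nonNeg s₂ {{nonNegative (fromℕ≥0 (6 ℕ.* d ℕ.* 2))}} ε≤1 ⟩
  s₂ * 1ℚ                                     ≡⟨ ℚ.*-identityʳ s₂ ⟩
  fromℕ (6 ℕ.* d ℕ.* 2)                       ≡⟨ cong fromℕ (trans (ℕ.*-comm (6 ℕ.* d) 2) (sym (ℕ.*-assoc 2 6 d))) ⟩
  fromℕ (12 ℕ.* d)                            ≤⟨ fromℕ-mono (ℕ.*-monoʳ-≤ 12 (d≤d³log d 1≤d)) ⟩
  fromℕ (12 ℕ.* X)                            ≡⟨ fromℕ-* 12 X ⟩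
  fromℕ 12 * fromℕ X                          ∎
  where
  open ℚ.≤-Reasoning
  open +-*-Solver using (solve; _:=_; _:*_)
  K  = ⌊1/ ε ⌋+1
  X  = d ℕ.^ 3 ℕ.* ⌈log₂ suc d ⌉
  s  = fromℕ (6 ℕ.* d)
  s₂ = fromℕ (6 ℕ.* d ℕ.* 2)

query-bound : ∀ d → 1 ℕ.≤ d → ∀ (ε : ℚ) .{{_ : Positive ε}} → ε ≤ 1ℚ → ∀ n m →
              fromℕ (rounds d ε ℕ.+ d ℕ.* (n ℕ.+ m)) ≤ fromℕ 12 * complexity d ε n m
query-bound d 1≤d ε ε≤1 n m = begin
  fromℕ (t ℕ.+ l)                               ≡⟨ fromℕ-+ t l ⟩
  fromℕ t + fromℕ l                             ≤⟨ ℚ.+-mono-≤ t-bound (fromℕ-mono (ℕ.m≤n*m l 12)) ⟩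
  fromℕ 12 * (X * 1/ε²) + fromℕ (12 ℕ.* l)      ≡⟨ cong (_+_ (fromℕ 12 * (X * 1/ε²))) (fromℕ-* 12 l) ⟩
  fromℕ 12 * (X * 1/ε²) + fromℕ 12 * fromℕ l    ≡⟨ solve 3 (λ c a b → c :* a :+ c :* b := c :* (b :+ a)) refl (fromℕ 12) (X * 1/ε²) (fromℕ l) ⟩
  fromℕ 12 * complexity d ε n m                 ∎
  where
  open ℚ.≤-Reasoning
  open +-*-Solver using (solve; _:=_; _:+_; _:*_)
  t = rounds d ε
  l = d ℕ.* (n ℕ.+ m)
  X = fromℕ (d ℕ.^ 3 ℕ.* ⌈log₂ suc d ⌉)
  instance
    ε²-pos : Positive (ε * ε)
    ε²-pos = ℚ.pos*pos⇒pos ε ε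
    ε²≢0 = ℚ.pos⇒nonZero (ε * ε)
  1/ε² = 1/ (ε * ε)
  t-bound : fromℕ t ≤ fromℕ 12 * (X * 1/ε²)
  t-bound = begin
    fromℕ t                       ≡⟨ ℚ.*-identityʳ (fromℕ t) ⟨
    fromℕ t * 1ℚ                  ≡⟨ cong (_*_ (fromℕ t)) (ℚ.*-inverseʳ (ε * ε)) ⟨
    fromℕ t * ((ε * ε) * 1/ε²)    ≡⟨ ℚ.*-assoc (fromℕ t) (ε * ε) 1/ε² ⟨
    fromℕ t * (ε * ε) * 1/ε²      ≤⟨ ℚ.*-monoʳ-≤-nonNeg 1/ε² {{ℚ.pos⇒nonNeg 1/ε² {{ℚ.1/pos⇒pos (ε * ε)}}}} (rounds-few d 1≤d ε ε≤1) ⟩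
    fromℕ 12 * X * 1/ε²           ≡⟨ ℚ.*-assoc (fromℕ 12) X 1/ε² ⟩
    fromℕ 12 * (X * 1/ε²)         ∎

theorem3 : Σ[ C₁ ∈ ℕ ] Σ[ C₂ ∈ ℕ ]
    Σ[ alg ∈ ((d : ℕ) (ε : ℚ) (n m : ℕ) → Algorithm n m (BinMatrix n d × BinMatrix d m)) ]
    ((d : ℕ) → 1 ≤ℕ d →
    (ε : ℚ) .{{_ : Positive ε}} → ε ≤ 1ℚ →
    (n m : ℕ) .{{_ : NonZero n}} .{{_ : NonZero m}} →
    (M : BinMatrix n m) (r : ℕ) → IsBinaryRank M r → r ≤ℕ d →
    ((+ 5 / 6) ≤ Pr (approximates? M (fromℕ C₁ * ε)) (alg d ε n m) M)
    × (fromℕ (queries (alg d ε n m) M) ≤ fromℕ C₂ * complexity d ε n m))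
-- The 2 comes from the triangle inequality in `round-close`, the 12 from the sample count in
-- `rounds-few`.
theorem3 = 2 , 12 , alg , proof
  where
  𝟎 : ∀ {n m} → BinMatrix n m
  𝟎 _ _ = false

  alg : (d : ℕ) (ε : ℚ) (n m : ℕ) → Algorithm n m (BinMatrix n d × BinMatrix d m)
  -- Positions can be drawn only from nonempty index sets; empty matrices lie outside the claim and
  -- get a default output.
  alg d ε zero    m       = output (𝟎 , 𝟎)
  alg d ε (suc n) zero    = output (𝟎 , 𝟎)
  -- The stopping time is random because the failure bound holds on average over stopping times. The
  -- toss has `suc (rounds d ε)` outcomes, so at most `rounds d ε` samples are taken.
  alg d ε (suc n) (suc m) = toss (rounds d ε) (λ t → run (round d ε) (toℕ t) 𝟎)

  proof : (d : ℕ) → 1 ≤ℕ d →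
    (ε : ℚ) .{{_ : Positive ε}} → ε ≤ 1ℚ →
    (n m : ℕ) .{{_ : NonZero n}} .{{_ : NonZero m}} →
    (M : BinMatrix n m) (r : ℕ) → IsBinaryRank M r → r ≤ℕ d →
    ((+ 5 / 6) ≤ Pr (approximates? M (fromℕ 2 * ε)) (alg d ε n m) M)
    × (fromℕ (queries (alg d ε n m) M) ≤ fromℕ 12 * complexity d ε n m)
  proof d 1≤d ε ε≤1 (suc n) (suc m) M r (F , _) r≤d = success , few
    where
    F′ : Factors M d
    F′ = factors-mono M (ℕ.≤⇒≤′ r≤d) F

    R : RankAtMost d (residual M 𝟎)
    R = RankAtMost-resp (λ i j → sym (xor-identityʳ (M i j))) (factors⇒rank M F′)

    P? = approximates? {d = d} M (fromℕ 2 * ε)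

    good : ∀ N → dist ⟦ M ⟧ ⟦ N ⟧ ≤ ε → Approximates M (fromℕ 2 * ε) (round d ε N)
    good N = round-close {n} {m} {d} ε M N F′

    success : + 5 / 6 ≤ Pr P? (alg d ε (suc n) (suc m)) M
    success = 5/6≤avg {rounds d ε} d ε (λ t → Pr P? (run (round d ε) (toℕ t) 𝟎) M) (rounds-enough d ε)
      (fewFailures M (round d ε) P? ε {{ℚ.pos⇒nonNeg ε}} good (suc (rounds d ε)) {d} 𝟎 R)

    few : fromℕ (queries (alg d ε (suc n) (suc m)) M) ≤ fromℕ 12 * complexity d ε (suc n) (suc m)
    few = ℚ.≤-trans
      (fromℕ-mono (foldr-⊔-≤ (λ (t : Fin (suc (rounds d ε))) → queries (run (round d ε) (toℕ t) 𝟎) M) λ t →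
        ℕ.≤-trans (queries-run (round d ε) {d} M (toℕ t) 𝟎 R)
                  (ℕ.+-monoˡ-≤ (d ℕ.* (suc n ℕ.+ suc m)) (toℕ≤pred[n] t))))
      (query-bound d 1≤d ε ε≤1 (suc n) (suc m))
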